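{- Let $G$ be any graph on $n$ vertices with maximum degree $\Delta$. Then $$HG(G) \leq 1+\frac{\Delta}{2}+ \frac{\sqrt{(\Delta +2)^2 + 2(n^2-3n-n\Delta)}}{2}.$$
   Context: Graphs are finite and simple, with at least one vertex. Let $G$ be a graph on $n$ vertices and let $k\ge 1$ be an integer. A $k$-coloring of $G$ is an arbitrary (not necessarily proper) map $c:V(G)\to\{1,\ldots,k\}$ (hat colors). A guessing strategy $\mathcal{S}$ with $k$ colors is a deterministic rule assigning to each vertex $v$ a function that takes the colors $(c(w))_{w\in N(v)}$ of the neighbors of $v$ (not including $v$ itself) and outputs a guess in $\{1,\ldots,k\}$. Vertex $v$ guesses correctly in $c$ if its guess equals $c(v)$. The strategy is winning if for every $k$-coloring $c$ at least one vertex guesses correctly. The hat guessing number $HG(G)$ is the largest $k$ for which a winning guessing strategy with $k$ colors exists. -}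

module Defs where

open import Data.Empty using (⊥)
open import Data.Fin using (Fin)
open import Data.Integer as ℤ using (ℤ; -[1+_])
import Data.Integer.Properties as ℤ
open import Data.List using (List; length; map; filter; allFin)
open import Data.List.Extrema.Nat using (max)
open import Data.Nat as ℕ using (ℕ; zero; suc)
import Data.Nat.Coprimality as Coprime
import Data.Nat.Properties as ℕ
open import Data.Product using (∃; ∃₂; ∃-syntax; _×_; _,_)
open import Data.Rational as ℚ
  using (ℚ; mkℚ; 0ℚ; 1ℚ; ½; _+_; _*_; _-_; -_; _<_; _≤_; 1/_; Positive; positive; nonNegative)
open import Data.Rational.Properties as ℚ
  using (<-trans; <-irrefl; <-dense; <-≤-trans; ≤-<-trans; <⇒≤; ≮⇒≥; _<?_)
import Data.Rational.Unnormalised as ℚᵘ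
import Data.Rational.Unnormalised.Properties as ℚᵘ
open import Data.Rational.Solver using (module +-*-Solver)
open import Data.Sum as Sum using (_⊎_; inj₁; inj₂)
open import Data.Vec as Vec using (Vec)
open import Level using (0ℓ)
open import Relation.Binary using (Rel; Symmetric; Irreflexive; Decidable; tri<; tri≈; tri>)
open import Relation.Binary.PropositionalEquality
  using (_≡_; refl; sym; trans; cong; subst; subst₂)
open import Relation.Nullary using (yes; no; contradiction)
open import Relation.Unary using (Pred; _∈_)

record Graph (n : ℕ) : Set₁ where
  field
    _~_    : Rel (Fin n) 0ℓ
    ~-sym  : Symmetric _~_
    ~-irr  : Irreflexive _≡_ _~_
    _~?_   : Decidable _~_

module _ {n : ℕ} (G : Graph n) where
  open Graph G

  neighbours : Fin n → List (Fin n)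
  neighbours v = filter (v ~?_) (allFin n)

  degree : Fin n → ℕ
  degree v = length (neighbours v)

  maxDegree : ℕ
  maxDegree = max 0 (map degree (allFin n))

  Colouring : ℕ → Set
  Colouring k = Fin n → Fin k

  -- The guess at v is a function of the tuple (c(w)) indexed by N(v), the
  -- neighbours being listed in increasing order.
  Strategy : ℕ → Set
  Strategy k = (v : Fin n) → Vec (Fin k) (degree v) → Fin k

  GuessesCorrectly : ∀ {k} → Strategy k → Colouring k → Fin n → Set
  GuessesCorrectly S c v = S v (Vec.map c (Vec.fromList (neighbours v))) ≡ c v

  Winning : ∀ {k} → Strategy k → Set
  Winning {k} S = (c : Colouring k) → ∃[ v ] GuessesCorrectly S c v

  Winnable : ℕ → Set
  Winnable k = (1 ℕ.≤ k) × ∃[ S ] Winning {k} S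

  IsHatGuessingNumber : ℕ → Set
  IsHatGuessingNumber h = Winnable h × (∀ k → Winnable k → k ℕ.≤ h)

-- Two-sided Dedekind cuts in ℚ.
record ℝ : Set₁ where
  field
    lower upper   : Pred ℚ 0ℓ
    lower-inhab   : ∃[ q ] q ∈ lower
    upper-inhab   : ∃[ q ] q ∈ upper
    lower-closed  : ∀ {p q} → p < q → q ∈ lower → p ∈ lower
    upper-closed  : ∀ {p q} → p < q → p ∈ upper → q ∈ upper
    lower-open    : ∀ {q} → q ∈ lower → ∃[ r ] (q < r × r ∈ lower)
    upper-open    : ∀ {q} → q ∈ upper → ∃[ r ] (r < q × r ∈ upper)
    disjoint      : ∀ {q} → q ∈ lower → q ∈ upper → ⊥
    located       : ∀ {p q} → p < q → p ∈ lower ⊎ q ∈ upper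

open ℝ

infix 4 _≤ℝ_

_≤ℝ_ : ℝ → ℝ → Set
x ≤ℝ y = ∀ {q} → q ∈ lower x → q ∈ lower y

private
  open +-*-Solver

  0<1 : 0ℚ < 1ℚ
  0<1 = ℚ.positive⁻¹ 1ℚ

  <⇒0<- : ∀ {p q} → p < q → 0ℚ < q - p
  <⇒0<- {p} {q} p<q = subst (_< q - p) (ℚ.+-inverseʳ p) (ℚ.+-monoˡ-< (- p) p<q)

  p<p+q : ∀ p {q} → 0ℚ < q → p < p + q
  p<p+q p {q} 0<q = subst (_< p + q) (ℚ.+-identityʳ p) (ℚ.+-monoʳ-< p 0<q)

  p-q<p : ∀ p {q} → 0ℚ < q → p - q < p
  p-q<p p {q} 0<q = subst (p - q <_) (ℚ.+-identityʳ p) (ℚ.+-monoʳ-< p (ℚ.neg-antimono-< 0<q))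

  0<p*q : ∀ {p q} → 0ℚ < p → 0ℚ < q → 0ℚ < p * q
  0<p*q {p} {q} 0<p 0<q =
    ℚ.positive⁻¹ (p * q) {{ℚ.pos*pos⇒pos p {{positive 0<p}} q {{positive 0<q}}}}

  square-mono-< : ∀ {p q} → 0ℚ ≤ p → p < q → p * p < q * q
  square-mono-< {p} {q} 0≤p p<q = ≤-<-trans
    (ℚ.*-monoˡ-≤-nonNeg p {{nonNegative 0≤p}} (<⇒≤ p<q))
    (ℚ.*-monoˡ-<-pos q {{positive (≤-<-trans 0≤p p<q)}} p<q)

  -- ε = δ / (m + δ)
  small : ∀ {m δ} → 0ℚ < m → 0ℚ < δ → ∃[ ε ] (0ℚ < ε × ε < 1ℚ × ε * m < δ)
  small {m} {δ} 0<m 0<δ = ε , 0<ε , ε<1 , subst (ε * m <_) eq (ℚ.*-monoʳ-<-pos ε m<m+δ)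
    where
    m<m+δ = p<p+q m 0<δ
    δ<m+δ : δ < m + δ
    δ<m+δ = subst (δ <_) (ℚ.+-comm δ m) (p<p+q δ 0<m)
    instance
      m+δ>0 : Positive (m + δ)
      m+δ>0 = positive (<-trans 0<m m<m+δ)
      m+δ≢0 : ℚ.NonZero (m + δ)
      m+δ≢0 = ℚ.pos⇒nonZero (m + δ)
    ε : ℚ
    ε = δ * 1/ (m + δ)
    0<ε : 0ℚ < ε
    0<ε = 0<p*q 0<δ (ℚ.positive⁻¹ (1/ (m + δ)) {{ℚ.1/pos⇒pos (m + δ)}})
    instance
      ε>0 : Positive ε
      ε>0 = positive 0<ε
    eq : ε * (m + δ) ≡ δ
    eq = trans (ℚ.*-assoc δ (1/ (m + δ)) (m + δ))
           (trans (cong (δ *_) (ℚ.*-inverseˡ (m + δ))) (ℚ.*-identityʳ δ))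
    ε<1 : ε < 1ℚ
    ε<1 = ℚ.*-cancelʳ-<-nonNeg (m + δ) {{ℚ.pos⇒nonNeg (m + δ)}}
      (subst₂ _<_ (sym eq) (sym (ℚ.*-identityˡ (m + δ))) δ<m+δ)

  fromℕ : ℕ → ℚ
  fromℕ m = mkℚ (ℤ.+ m) 0 (Coprime.sym (Coprime.1-coprimeTo m))

  fromℕ-suc : ∀ m → fromℕ (suc m) ≡ 1ℚ + fromℕ m
  fromℕ-suc m = ℚ.toℚᵘ-injective (ℚᵘ.≃-trans
    (ℚᵘ.*≡* (cong (λ k → (ℤ.+ 1 ℤ.+ k) ℤ.* ℤ.+ 1) (sym (ℤ.*-identityʳ (ℤ.+ m)))))
    (ℚᵘ.≃-sym (ℚ.toℚᵘ-homo-+ 1ℚ (fromℕ m))))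

  ≤-numerator : ∀ p → p ≤ fromℕ ℤ.∣ ℚ.↥ p ∣
  ≤-numerator (mkℚ (ℤ.+ n) d _) = ℚ.*≤* (subst₂ ℤ._≤_ (ℤ.pos-* n 1) (ℤ.pos-* n (suc d))
    (ℤ.+≤+ (ℕ.*-monoʳ-≤ n (ℕ.s≤s ℕ.z≤n))))
  ≤-numerator (mkℚ -[1+ n ] d _) = ℚ.*≤* ℤ.-≤+

  archimedean : ∀ x {δ} → 0ℚ < δ → ∃[ m ] x ≤ fromℕ m * δ
  archimedean x {δ} 0<δ = ℤ.∣ ℚ.↥ c ∣ ,
    subst (_≤ fromℕ ℤ.∣ ℚ.↥ c ∣ * δ) eq (ℚ.*-monoʳ-≤-nonNeg δ (≤-numerator c))
    where
    instance
      δ>0 : Positive δ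
      δ>0 = positive 0<δ
      δ≥0 : ℚ.NonNegative δ
      δ≥0 = ℚ.pos⇒nonNeg δ
      δ≢0 : ℚ.NonZero δ
      δ≢0 = ℚ.pos⇒nonZero δ
    c : ℚ
    c = x * 1/ δ
    eq : c * δ ≡ x
    eq = trans (ℚ.*-assoc x (1/ δ) δ) (trans (cong (x *_) (ℚ.*-inverseˡ δ)) (ℚ.*-identityʳ x))

  halving : ∀ x → x * ½ + x * ½ ≡ x
  halving x = trans (sym (ℚ.*-distribˡ-+ x ½ ½)) (ℚ.*-identityʳ x)

  0<halve : ∀ {x} → 0ℚ < x → 0ℚ < x * ½
  0<halve 0<x = 0<p*q 0<x (ℚ.positive⁻¹ ½)

  halve-mono : ∀ {p q} → p < q → p * ½ < q * ½
  halve-mono = ℚ.*-monoˡ-<-pos ½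

  double-halve : ∀ q → (q + q) * ½ ≡ q
  double-halve q = trans (ℚ.*-distribʳ-+ ½ q q) (halving q)

  lower<upper : ∀ x {p q} → p ∈ lower x → q ∈ upper x → p < q
  lower<upper x {p} {q} p∈L q∈U with ℚ.<-cmp p q
  ... | tri< p<q _ _   = p<q
  ... | tri≈ _ refl _  = contradiction q∈U (disjoint x p∈L)
  ... | tri> _ _ q<p   = contradiction q∈U (disjoint x (lower-closed x q<p p∈L))

  -- Walk up from a in steps of δ until the cut is crossed.
  walk : ∀ x {δ} → 0ℚ < δ → ∀ m {a} → a ∈ lower x → a + fromℕ m * δ ∈ upper x →
         ∃[ b ] (b ∈ lower x × b + (δ + δ) ∈ upper x)
  walk x {δ} 0<δ zero {a} a∈L a∈U =
    contradiction (subst (_∈ upper x) eq a∈U) (disjoint x a∈L)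
    where
    eq : a + fromℕ 0 * δ ≡ a
    eq = trans (cong (a +_) (ℚ.*-zeroˡ δ)) (ℚ.+-identityʳ a)
  walk x {δ} 0<δ (suc m) {a} a∈L a∈U
    with located x (subst (a + δ <_) (ℚ.+-assoc a δ δ) (p<p+q (a + δ) 0<δ))
  ... | inj₁ a+δ∈L  = walk x 0<δ m a+δ∈L (subst (_∈ upper x) eq a∈U)
    where
    eq : a + fromℕ (suc m) * δ ≡ a + δ + fromℕ m * δ
    eq = trans (cong (λ k → a + k * δ) (fromℕ-suc m))
      (solve 3 (λ a k δ → a :+ (con 1ℚ :+ k) :* δ := a :+ δ :+ k :* δ) refl a (fromℕ m) δ)
  ... | inj₂ a+2δ∈U = a , a∈L , a+2δ∈U

  narrow : ∀ x {ε} → 0ℚ < ε → ∃[ b ] (b ∈ lower x × b + ε ∈ upper x)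
  narrow x {ε} 0<ε =
    let a , a∈L = lower-inhab x
        u , u∈U = upper-inhab x
        v , u<v , v∈U = above u∈U
        m , v-a≤mδ = archimedean (v - a) 0<δ
        b , b∈L , b+2δ∈U = walk x 0<δ m a∈L (upper-closed x (u<a+k a u<v v-a≤mδ) u∈U)
    in b , b∈L , subst (λ e → b + e ∈ upper x) (halving ε) b+2δ∈U
    where
    0<δ : 0ℚ < ε * ½
    0<δ = 0<halve 0<ε
    above : ∀ {u} → u ∈ upper x → ∃[ v ] (u < v × v ∈ upper x)
    above {u} u∈U = u + 1ℚ , p<p+q u 0<1 , upper-closed x (p<p+q u 0<1) u∈U
    u<a+k : ∀ {u v k} a → u < v → v - a ≤ k → u < a + k
    u<a+k {u} {v} {k} a u<v v-a≤k = <-≤-trans u<v (subst (_≤ a + k)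
      (solve 2 (λ v a → a :+ (v :- a) := v) refl v a) (ℚ.+-monoʳ-≤ a v-a≤k))

fromℚ : ℚ → ℝ
fromℚ x = record
  { lower         = _< x
  ; upper         = x <_
  ; lower-inhab   = x - 1ℚ , p-q<p x 0<1
  ; upper-inhab   = x + 1ℚ , p<p+q x 0<1
  ; lower-closed  = <-trans
  ; upper-closed  = λ p<q x<p → <-trans x<p p<q
  ; lower-open    = <-dense
  ; upper-open    = λ x<q → let r , x<r , r<q = <-dense x<q in r , r<q , x<r
  ; disjoint      = λ q<x x<q → <-irrefl refl (<-trans q<x x<q)
  ; located       = loc
  }
  where
  loc : ∀ {p q} → p < q → p < x ⊎ x < q
  loc {p} p<q with p <? x
  ... | yes p<x = inj₁ p<x
  ... | no  p≮x = inj₂ (≤-<-trans (≮⇒≥ p≮x) p<q)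

fromℤ : ℤ → ℝ
fromℤ z = fromℚ (z ℚ./ 1)

infixl 6 _+ℝ_

_+ℝ_ : ℝ → ℝ → ℝ
x +ℝ y = record
  { lower         = λ q → ∃₂ λ a b → a ∈ lower x × b ∈ lower y × q ≡ a + b
  ; upper         = λ q → ∃₂ λ a b → a ∈ upper x × b ∈ upper y × q ≡ a + b
  ; lower-inhab   = let a , a∈L = lower-inhab x ; b , b∈L = lower-inhab y
                    in a + b , a , b , a∈L , b∈L , refl
  ; upper-inhab   = let a , a∈U = upper-inhab x ; b , b∈U = upper-inhab y
                    in a + b , a , b , a∈U , b∈U , refl
  ; lower-closed  = λ { {p} p<q (a , b , a∈L , b∈L , refl) →
                      a , p - a , a∈L , lower-closed y (p-a<b p<q) b∈L , split p a }
  ; upper-closed  = λ { {q = q} p<q (a , b , a∈U , b∈U , refl) →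
                      a , q - a , a∈U , upper-closed y (b<q-a p<q) b∈U , split q a }
  ; lower-open    = λ { (a , b , a∈L , b∈L , refl) →
                      let a′ , a<a′ , a′∈L = lower-open x a∈L
                      in a′ + b , ℚ.+-monoˡ-< b a<a′ , a′ , b , a′∈L , b∈L , refl }
  ; upper-open    = λ { (a , b , a∈U , b∈U , refl) →
                      let a′ , a′<a , a′∈U = upper-open x a∈U
                      in a′ + b , ℚ.+-monoˡ-< b a′<a , a′ , b , a′∈U , b∈U , refl }
  ; disjoint      = λ { (a , b , a∈L , b∈L , refl) (c , d , c∈U , d∈U , eq) →
                      <-irrefl eq (ℚ.+-mono-< (lower<upper x a∈L c∈U) (lower<upper y b∈L d∈U)) }
  ; located       = loc
  }
  where
  split : ∀ p a → p ≡ a + (p - a)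
  split = solve 2 (λ p a → p := a :+ (p :- a)) refl

  cancel : ∀ a b → a + b - a ≡ b
  cancel = solve 2 (λ a b → a :+ b :- a := b) refl

  p-a<b : ∀ {p a b} → p < a + b → p - a < b
  p-a<b {p} {a} {b} p<a+b = subst (p - a <_) (cancel a b) (ℚ.+-monoˡ-< (- a) p<a+b)

  b<q-a : ∀ {q a b} → a + b < q → b < q - a
  b<q-a {q} {a} {b} a+b<q = subst (_< q - a) (cancel a b) (ℚ.+-monoˡ-< (- a) a+b<q)

  loc : ∀ {p q} → p < q →
        (∃₂ λ a b → a ∈ lower x × b ∈ lower y × p ≡ a + b) ⊎
        (∃₂ λ a b → a ∈ upper x × b ∈ upper y × q ≡ a + b)
  loc {p} {q} p<q =
    let ε , 0<ε , p+2ε≡q = half p<q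
        a , a∈L , a+ε∈U = narrow x 0<ε
    in Sum.map
         (λ p-a∈L → a , p - a , a∈L , p-a∈L , split p a)
         (λ q-a-ε∈U → a + ε , q - (a + ε) , a+ε∈U , q-a-ε∈U , split q (a + ε))
         (located y (gap {p} a 0<ε p+2ε≡q))
    where
    half : ∀ {p q} → p < q → ∃[ ε ] (0ℚ < ε × p + (ε + ε) ≡ q)
    half {p} {q} p<q = (q - p) * ½ , 0<halve (<⇒0<- p<q) ,
      trans (cong (λ d → p + d) (halving (q - p))) (sym (split q p))
    gap : ∀ {p q ε} a → 0ℚ < ε → p + (ε + ε) ≡ q → p - a < q - (a + ε)
    gap {p} {ε = ε} a 0<ε refl = subst (p - a <_)
      (solve 3 (λ p a ε → p :- a :+ ε := p :+ (ε :+ ε) :- (a :+ ε)) refl p a ε)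
      (p<p+q (p - a) 0<ε)

infix 7 _/2

_/2 : ℝ → ℝ
x /2 = record
  { lower         = λ q → q + q ∈ lower x
  ; upper         = λ q → q + q ∈ upper x
  ; lower-inhab   = let q , q∈L = lower-inhab x
                    in q * ½ , subst (_∈ lower x) (sym (halving q)) q∈L
  ; upper-inhab   = let q , q∈U = upper-inhab x
                    in q * ½ , subst (_∈ upper x) (sym (halving q)) q∈U
  ; lower-closed  = λ p<q → lower-closed x (ℚ.+-mono-< p<q p<q)
  ; upper-closed  = λ p<q → upper-closed x (ℚ.+-mono-< p<q p<q)
  ; lower-open    = λ {q} q∈L → let r , q<r , r∈L = lower-open x q∈L
                    in r * ½ , subst (_< r * ½) (double-halve q) (halve-mono q<r)
                             , subst (_∈ lower x) (sym (halving r)) r∈L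
  ; upper-open    = λ {q} q∈U → let r , r<q , r∈U = upper-open x q∈U
                    in r * ½ , subst (r * ½ <_) (double-halve q) (halve-mono r<q)
                             , subst (_∈ upper x) (sym (halving r)) r∈U
  ; disjoint      = disjoint x
  ; located       = λ p<q → located x (ℚ.+-mono-< p<q p<q)
  }

-- The square root of the nonnegative reals, extended by √ x = 0 for x < 0.
√ : ℝ → ℝ
√ x = record
  { lower         = L
  ; upper         = U
  ; lower-inhab   = - 1ℚ , inj₁ (ℚ.negative⁻¹ (- 1ℚ))
  ; upper-inhab   = inhab
  ; lower-closed  = closedL
  ; upper-closed  = λ p<q (0<p , p²∈U) →
                      <-trans 0<p p<q , upper-closed x (square-mono-< (<⇒≤ 0<p) p<q) p²∈U
  ; lower-open    = openL
  ; upper-open    = openU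
  ; disjoint      = λ { (inj₁ q<0) (0<q , _) → <-irrefl refl (<-trans q<0 0<q)
                      ; (inj₂ q²∈L) (_ , q²∈U) → disjoint x q²∈L q²∈U }
  ; located       = loc
  }
  where
  L U : Pred ℚ 0ℓ
  L q = q < 0ℚ ⊎ q * q ∈ lower x
  U q = 0ℚ < q × q * q ∈ upper x

  inhab : ∃[ q ] q ∈ U
  inhab with upper-inhab x
  ... | u , u∈U with 1ℚ <? u
  ...   | yes 1<u = u , <-trans 0<1 1<u ,
            upper-closed x (subst (_< u * u) (ℚ.*-identityˡ u)
              (ℚ.*-monoˡ-<-pos u {{positive (<-trans 0<1 1<u)}} 1<u)) u∈U
  ...   | no  1≮u = 1ℚ + 1ℚ , ℚ.positive⁻¹ (1ℚ + 1ℚ) ,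
            upper-closed x (≤-<-trans (≮⇒≥ 1≮u) (square-mono-< (<⇒≤ 0<1) (p<p+q 1ℚ 0<1))) u∈U

  closedL : ∀ {p q} → p < q → q ∈ L → p ∈ L
  closedL p<q (inj₁ q<0) = inj₁ (<-trans p<q q<0)
  closedL {p} p<q (inj₂ q²∈L) with p <? 0ℚ
  ... | yes p<0 = inj₁ p<0
  ... | no  p≮0 = inj₂ (lower-closed x (square-mono-< (≮⇒≥ p≮0) p<q) q²∈L)

  openL : ∀ {q} → q ∈ L → ∃[ r ] (q < r × r ∈ L)
  openL (inj₁ q<0) = let r , q<r , r<0 = <-dense q<0 in r , q<r , inj₁ r<0
  openL {q} (inj₂ q²∈L) with q <? 0ℚ
  ... | yes q<0 = let r , q<r , r<0 = <-dense q<0 in r , q<r , inj₁ r<0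
  ... | no  q≮0 =
    let s , q²<s , s∈L = lower-open x q²∈L
        ε , 0<ε , ε<1 , εm<δ = small 0<m (<⇒0<- q²<s)
    in q + ε , p<p+q q 0<ε , inj₂ (lower-closed x (r²<s 0<ε ε<1 εm<δ) s∈L)
    where
    0<m : 0ℚ < q + q + 1ℚ
    0<m = ≤-<-trans (ℚ.+-mono-≤ (≮⇒≥ q≮0) (≮⇒≥ q≮0)) (p<p+q (q + q) 0<1)
    r²<s : ∀ {s ε} → 0ℚ < ε → ε < 1ℚ → ε * (q + q + 1ℚ) < s - q * q →
           (q + ε) * (q + ε) < s
    r²<s {s} {ε} 0<ε ε<1 εm<δ = <-trans
      (subst₂ _<_
        (solve 2 (λ q ε → q :* q :+ ε :* (q :+ q) :+ ε :* ε := (q :+ ε) :* (q :+ ε)) refl q ε)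
        (solve 3 (λ q ε i → q :* q :+ ε :* (q :+ q) :+ ε :* i
                         := q :* q :+ ε :* (q :+ q :+ i)) refl q ε 1ℚ)
        (ℚ.+-monoʳ-< (q * q + ε * (q + q)) (ℚ.*-monoʳ-<-pos ε {{positive 0<ε}} ε<1)))
      (subst (q * q + ε * (q + q + 1ℚ) <_)
        (solve 2 (λ t s → t :+ (s :- t) := s) refl (q * q) s)
        (ℚ.+-monoʳ-< (q * q) εm<δ))

  openU : ∀ {q} → q ∈ U → ∃[ r ] (r < q × r ∈ U)
  openU {q} (0<q , q²∈U) =
    let s , s<q² , s∈U = upper-open x q²∈U
        η , 0<η , η<1 , ηm<δ = small 0<m (<⇒0<- s<q²)
    in q - q * η , p-q<p q (0<p*q 0<q 0<η) , <⇒0<- (qη<q η<1) ,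
       upper-closed x (s<r² 0<η ηm<δ) s∈U
    where
    0<m : 0ℚ < q * q + q * q
    0<m = <-trans (0<p*q 0<q 0<q) (p<p+q (q * q) (0<p*q 0<q 0<q))
    qη<q : ∀ {η} → η < 1ℚ → q * η < q
    qη<q {η} η<1 = subst (q * η <_) (ℚ.*-identityʳ q) (ℚ.*-monoʳ-<-pos q {{positive 0<q}} η<1)
    s<r² : ∀ {s η} → 0ℚ < η → η * (q * q + q * q) < q * q - s →
           s < (q - q * η) * (q - q * η)
    s<r² {s} {η} 0<η ηm<δ = <-trans
      (subst₂ _<_
        (solve 2 (λ s d → s :+ d :- d := s) refl s d)
        (solve 3 (λ s t d → s :+ (t :- s) :- d := t :- d) refl s (q * q) d)
        (ℚ.+-monoˡ-< (- d) (ℚ.+-monoʳ-< s ηm<δ)))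
      (subst (q * q - d <_)
        (solve 2 (λ q η → q :* q :- η :* (q :* q :+ q :* q) :+ q :* η :* (q :* η)
                       := (q :- q :* η) :* (q :- q :* η)) refl q η)
        (p<p+q (q * q - d) (0<p*q (0<p*q 0<q 0<η) (0<p*q 0<q 0<η))))
      where
      d : ℚ
      d = η * (q * q + q * q)

  loc : ∀ {p q} → p < q → p ∈ L ⊎ q ∈ U
  loc {p} p<q with p <? 0ℚ
  ... | yes p<0 = inj₁ (inj₁ p<0)
  ... | no  p≮0 with located x (square-mono-< (≮⇒≥ p≮0) p<q)
  ...   | inj₁ p²∈L = inj₁ (inj₂ p²∈L)
  ...   | inj₂ q²∈U = inj₂ (≤-<-trans (≮⇒≥ p≮0) p<q , q²∈U)

{-# OPTIONS --safe #-}

-- Let k = s + 1. For a random colouring c let X be the number of vertices that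
-- guess correctly and R the number of those adjacent to all other such vertices.
-- Call v quiet if no vertex outside N(v) ∪ {v} is correct. Whether v is quiet does
-- not depend on c(v), so given that v is quiet it is correct with probability 1/k;
-- hence the expected number of quiet vertices is k E[R]. If u is correct, every
-- quiet vertex is a neighbour of u or counted by R, so k E[R] ≤ Δ + E[R].
-- Moreover X + R ≥ 2 always and E[X] = n/k, which gives 2sk ≤ kΔ + sn. Together
-- with k ≤ n and Δ < n this implies 2s(s − Δ) ≤ (n − 2)(n − 1 − Δ), which is the
-- theorem after completing the square.

module Submission where

open import Defs
open import Data.Nat using (ℕ; NonZero)
open import Data.Integer using (+_; _+_; _-_; _*_; _^_)

open import Data.Fin using (Fin; zero; suc)
open import Data.Fin.Properties as Fin using (all?)
open import Data.Integer as ℤ using (ℤ)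
import Data.Integer.Properties as ℤ
import Data.Integer.Tactic.RingSolver as ℤ-Ring
open import Data.List as List using (List; length; filter; allFin)
open import Data.List.Extrema.Nat using (xs≤max; max≤v⁺)
open import Data.List.Membership.Propositional.Properties using (∈-allFin)
open import Data.List.Properties using (filter-notAll; length-tabulate)
open import Data.List.Relation.Unary.All as All using (All)
import Data.List.Relation.Unary.All.Properties as All
import Data.List.Relation.Unary.Any as Any
open import Data.Nat as ℕ using (zero; suc)
import Data.Nat.Properties as ℕ
import Data.Nat.Tactic.RingSolver as ℕ-Ring
open import Data.Product using (∃-syntax; _,_; proj₁; proj₂)
open import Data.Rational as ℚ using (ℚ; 0ℚ; 1ℚ; ½)
import Data.Rational.Properties as ℚ
open import Data.Rational.Solver using (module +-*-Solver)
import Data.Rational.Unnormalised as ℚᵘ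
import Data.Rational.Unnormalised.Properties as ℚᵘ
open import Data.Sum using (_⊎_; inj₁; inj₂)
open import Data.Vec as Vec using (Vec; []; _∷_; lookup; _[_]≔_)
import Data.Vec.Properties as Vec
open import Function using (_∘_)
open import Relation.Binary.PropositionalEquality
  using (_≡_; _≢_; refl; sym; trans; cong; cong₂; subst; subst₂; module ≡-Reasoning)
open import Relation.Nullary using (Dec; yes; no; ¬_; ¬?; contradiction)
open import Relation.Nullary.Decidable using (_→-dec_; _×-dec_)
open import Relation.Unary using (Pred; Decidable)

open import Algebra.Properties.Semiring.Sum ℕ.+-*-semiring using
  ( sum; sum-cong-≗; ∑-distrib-+; ∑-comm; sum-replicate-zero
  ; *-distribˡ-sum; *-distribʳ-sum )

-- Indicators and finite sums of naturals.

⟦_⟧ : ∀ {a} {A : Set a} → Dec A → ℕ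
⟦ yes _ ⟧ = 1
⟦ no  _ ⟧ = 0

⟦⟧-yes : ∀ {a} {A : Set a} (A? : Dec A) → A → ⟦ A? ⟧ ≡ 1
⟦⟧-yes (yes _) _ = refl
⟦⟧-yes (no ¬a) a = contradiction a ¬a

⟦⟧-cong : ∀ {a b} {A : Set a} {B : Set b} (A? : Dec A) (B? : Dec B) →
          (A → B) → (B → A) → ⟦ A? ⟧ ≡ ⟦ B? ⟧
⟦⟧-cong (yes a) (yes b) _ _ = refl
⟦⟧-cong (yes a) (no ¬b) f _ = contradiction (f a) ¬b
⟦⟧-cong (no ¬a) (yes b) _ g = contradiction (g b) ¬a
⟦⟧-cong (no ¬a) (no ¬b) _ _ = refl

sum-mono : ∀ {n} {f g : Fin n → ℕ} → (∀ i → f i ℕ.≤ g i) → sum f ℕ.≤ sum g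
sum-mono {zero}  f≤g = ℕ.z≤n
sum-mono {suc n} f≤g = ℕ.+-mono-≤ (f≤g zero) (sum-mono (f≤g ∘ suc))

sum-const : ∀ n m → sum {n} (λ _ → m) ≡ n ℕ.* m
sum-const zero    m = refl
sum-const (suc n) m = cong (m ℕ.+_) (sum-const n m)

term≤sum : ∀ {n} (f : Fin n → ℕ) i → f i ℕ.≤ sum f
term≤sum f zero    = ℕ.m≤m+n _ _
term≤sum f (suc i) = ℕ.≤-trans (term≤sum (f ∘ suc) i) (ℕ.m≤n+m _ _)

terms≤sum : ∀ {n} (f : Fin n → ℕ) {i j} → i ≢ j → f i ℕ.+ f j ℕ.≤ sum f
terms≤sum f {zero}  {zero}  i≢j = contradiction refl i≢j
terms≤sum f {zero}  {suc j} i≢j = ℕ.+-monoʳ-≤ (f zero) (term≤sum (f ∘ suc) j)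
terms≤sum f {suc i} {zero}  i≢j =
  subst (ℕ._≤ sum f) (ℕ.+-comm (f zero) _) (ℕ.+-monoʳ-≤ (f zero) (term≤sum (f ∘ suc) i))
terms≤sum f {suc i} {suc j} i≢j =
  ℕ.≤-trans (terms≤sum (f ∘ suc) (i≢j ∘ cong suc)) (ℕ.m≤n+m _ _)

-- This becomes the probability 1/k: exactly one of the k colours of a vertex agrees with a fixed
-- guess.
sum-≟ : ∀ {n} (i : Fin n) → sum (λ j → ⟦ i Fin.≟ j ⟧) ≡ 1
sum-≟ {suc n} zero    = cong suc (trans (sum-cong-≗ {n} (λ _ → refl)) (sum-replicate-zero n))
sum-≟ {suc n} (suc i) = trans
  (sum-cong-≗ (λ j → ⟦⟧-cong (suc i Fin.≟ suc j) (i Fin.≟ j) Fin.suc-injective (cong suc)))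
  (sum-≟ i)

length-filter-tabulate : ∀ {a p} {A : Set a} {P : Pred A p} (P? : Decidable P) {n} (f : Fin n → A) →
  length (filter P? (List.tabulate f)) ≡ sum (λ i → ⟦ P? (f i) ⟧)
length-filter-tabulate P? {zero}  f = refl
length-filter-tabulate P? {suc n} f with P? (f zero)
... | yes _ = cong suc (length-filter-tabulate P? (f ∘ suc))
... | no  _ = length-filter-tabulate P? (f ∘ suc)

-- Sums over all colourings.

module _ {k : ℕ} where

  -- Vectors stand in for colourings, so that the sum recurses on the length and `_[_]≔_` recolours
  -- one vertex; `lookup` recovers a `Colouring`.
  ∑ᵛ : ∀ n → (Vec (Fin k) n → ℕ) → ℕ
  ∑ᵛ zero    f = f []
  ∑ᵛ (suc n) f = sum (λ a → ∑ᵛ n (λ c → f (a ∷ c)))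

  ∑ᵛ-cong : ∀ {n} {f g} → (∀ c → f c ≡ g c) → ∑ᵛ n f ≡ ∑ᵛ n g
  ∑ᵛ-cong {zero}  f≡g = f≡g []
  ∑ᵛ-cong {suc n} f≡g = sum-cong-≗ (λ a → ∑ᵛ-cong (λ c → f≡g (a ∷ c)))

  ∑ᵛ-mono : ∀ {n} {f g} → (∀ c → f c ℕ.≤ g c) → ∑ᵛ n f ℕ.≤ ∑ᵛ n g
  ∑ᵛ-mono {zero}  f≤g = f≤g []
  ∑ᵛ-mono {suc n} f≤g = sum-mono (λ a → ∑ᵛ-mono (λ c → f≤g (a ∷ c)))

  ∑ᵛ-const : ∀ n m → ∑ᵛ n (λ _ → m) ≡ k ℕ.^ n ℕ.* m
  ∑ᵛ-const zero    m = sym (ℕ.*-identityˡ m)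
  ∑ᵛ-const (suc n) m = begin
    sum {k} (λ _ → ∑ᵛ n (λ _ → m))  ≡⟨ sum-const k _ ⟩
    k ℕ.* ∑ᵛ n (λ _ → m)            ≡⟨ cong (k ℕ.*_) (∑ᵛ-const n m) ⟩
    k ℕ.* (k ℕ.^ n ℕ.* m)           ≡⟨ ℕ.*-assoc k (k ℕ.^ n) m ⟨
    k ℕ.^ suc n ℕ.* m               ∎
    where open ≡-Reasoning

  ∑ᵛ-distrib-+ : ∀ n f g → ∑ᵛ n (λ c → f c ℕ.+ g c) ≡ ∑ᵛ n f ℕ.+ ∑ᵛ n g
  ∑ᵛ-distrib-+ zero    f g = refl
  ∑ᵛ-distrib-+ (suc n) f g = trans
    (sum-cong-≗ (λ a → ∑ᵛ-distrib-+ n (λ c → f (a ∷ c)) (λ c → g (a ∷ c))))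
    (∑-distrib-+ {k} (λ a → ∑ᵛ n (λ c → f (a ∷ c))) (λ a → ∑ᵛ n (λ c → g (a ∷ c))))

  ∑ᵛ-comm : ∀ n {m} (f : Vec (Fin k) n → Fin m → ℕ) →
            ∑ᵛ n (λ c → sum (f c)) ≡ sum (λ i → ∑ᵛ n (λ c → f c i))
  ∑ᵛ-comm zero    f = refl
  ∑ᵛ-comm (suc n) f = trans (sum-cong-≗ (λ a → ∑ᵛ-comm n (λ c → f (a ∷ c))))
    (∑-comm (λ a i → ∑ᵛ n (λ c → f (a ∷ c) i)))

  -- Overwriting coordinate `v` forgets its old value, which ranges over `k` colours, so every
  -- vector is hit `k` times.
  ∑ᵛ-resample : ∀ {n} (v : Fin n) f →
                k ℕ.* ∑ᵛ n f ≡ ∑ᵛ n (λ c → sum (λ a → f (c [ v ]≔ a)))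
  ∑ᵛ-resample {suc n} zero f = begin
    k ℕ.* ∑ᵛ (suc n) f
      ≡⟨ sum-const k _ ⟨
    sum {k} (λ _ → sum (λ a → ∑ᵛ n (λ c → f (a ∷ c))))
      ≡⟨ sum-cong-≗ {k} (λ _ → sym (∑ᵛ-comm n (λ c a → f (a ∷ c)))) ⟩
    ∑ᵛ (suc n) (λ c → sum (λ a → f (c [ zero ]≔ a))) ∎
    where open ≡-Reasoning
  ∑ᵛ-resample {suc n} (suc v) f = trans (*-distribˡ-sum {k} k _)
    (sum-cong-≗ (λ a → ∑ᵛ-resample v (λ c → f (a ∷ c))))

-- Counting correct and quiet vertices for a fixed strategy.

module HatGuessing {n k : ℕ} (G : Graph n) (S : Strategy G k) where

  open Graph G

  Correct : Vec (Fin k) n → Fin n → Set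
  Correct c = GuessesCorrectly G S (lookup c)

  guess : Vec (Fin k) n → Fin n → Fin k
  guess c v = S v (Vec.map (lookup c) (Vec.fromList (neighbours G v)))

  correct? : ∀ c v → Dec (Correct c v)
  correct? c v = guess c v Fin.≟ lookup c v

  Quiet : Vec (Fin k) n → Fin n → Set
  Quiet c v = ∀ u → u ≢ v → ¬ (u ~ v) → ¬ Correct c u

  quiet? : ∀ c v → Dec (Quiet c v)
  quiet? c v = all? (λ u → ¬? (u Fin.≟ v) →-dec (¬? (u ~? v) →-dec ¬? (correct? c u)))

  map-update : ∀ (c : Vec (Fin k) n) v a xs → All (_≢ v) xs →
    Vec.map (lookup (c [ v ]≔ a)) (Vec.fromList xs) ≡ Vec.map (lookup c) (Vec.fromList xs)
  map-update c v a _ All.[]       = refl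
  map-update c v a _ (u≢v All.∷ ps) =
    cong₂ _∷_ (Vec.lookup∘update′ u≢v c a) (map-update c v a _ ps)

  -- The guess at `u` reads only colours of neighbours of `u`. By irreflexivity this includes the
  -- case where `u` is `v`, on which `correct-independent` relies.
  guess-update : ∀ c {u v} a → ¬ (u ~ v) → guess (c [ v ]≔ a) u ≡ guess c u
  guess-update c {u} {v} a u≁v = cong (S u) (map-update c v a (neighbours G u)
    (All.map (λ u~w w≡v → u≁v (subst (u ~_) w≡v u~w)) (All.all-filter (u ~?_) (allFin n))))

  correct-update : ∀ c {u v} a → u ≢ v → ¬ (u ~ v) → Correct c u → Correct (c [ v ]≔ a) u
  correct-update c a u≢v u≁v cu =
    trans (guess-update c a u≁v) (trans cu (sym (Vec.lookup∘update′ u≢v c a)))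

  correct-update⁻ : ∀ c {u v} a → u ≢ v → ¬ (u ~ v) → Correct (c [ v ]≔ a) u → Correct c u
  correct-update⁻ c a u≢v u≁v cu =
    trans (sym (guess-update c a u≁v)) (trans cu (Vec.lookup∘update′ u≢v c a))

  -- `Quiet` at `v` concerns only vertices other than `v` and not adjacent to it; recolouring `v`
  -- changes neither their colours nor their guesses.
  quiet-update : ∀ c v a → ⟦ quiet? (c [ v ]≔ a) v ⟧ ≡ ⟦ quiet? c v ⟧
  quiet-update c v a = ⟦⟧-cong (quiet? (c [ v ]≔ a) v) (quiet? c v)
    (λ q u u≢v u≁v cu → q u u≢v u≁v (correct-update c a u≢v u≁v cu))
    (λ q u u≢v u≁v cu → q u u≢v u≁v (correct-update⁻ c a u≢v u≁v cu))

  -- A vertex guesses correctly with probability 1/k independently of every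
  -- quantity y that ignores its own colour.
  correct-independent : ∀ v (y : Vec (Fin k) n → ℕ) → (∀ c a → y (c [ v ]≔ a) ≡ y c) →
    k ℕ.* ∑ᵛ n (λ c → ⟦ correct? c v ⟧ ℕ.* y c) ≡ ∑ᵛ n y
  correct-independent v y inv = trans (∑ᵛ-resample v _) (∑ᵛ-cong λ c → begin
    sum (λ a → ⟦ correct? (c [ v ]≔ a) v ⟧ ℕ.* y (c [ v ]≔ a))
      ≡⟨ sum-cong-≗ (λ a → cong₂ ℕ._*_ (hit c a) (inv c a)) ⟩
    sum (λ a → ⟦ guess c v Fin.≟ a ⟧ ℕ.* y c)
      ≡⟨ *-distribʳ-sum (y c) (λ a → ⟦ guess c v Fin.≟ a ⟧) ⟨
    sum (λ a → ⟦ guess c v Fin.≟ a ⟧) ℕ.* y c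
      ≡⟨ cong (ℕ._* y c) (sum-≟ (guess c v)) ⟩
    1 ℕ.* y c
      ≡⟨ ℕ.*-identityˡ (y c) ⟩
    y c ∎)
    where
    open ≡-Reasoning
    hit : ∀ c a → ⟦ correct? (c [ v ]≔ a) v ⟧ ≡ ⟦ guess c v Fin.≟ a ⟧
    hit c a = ⟦⟧-cong (correct? (c [ v ]≔ a) v) (guess c v Fin.≟ a)
      (λ eq → trans (sym (guess-update c a (~-irr refl))) (trans eq (Vec.lookup∘update v c a)))
      (λ eq → trans (guess-update c a (~-irr refl)) (trans eq (sym (Vec.lookup∘update v c a))))

  -- These are X and R. A correct vertex is quiet exactly when it is isolated in the non-adjacency
  -- graph on the correct vertices.
  #correct #isolated : Vec (Fin k) n → ℕ
  #correct  c = sum (λ v → ⟦ correct? c v ⟧)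
  #isolated c = sum (λ v → ⟦ correct? c v ⟧ ℕ.* ⟦ quiet? c v ⟧)

  correct-total : k ℕ.* ∑ᵛ n #correct ≡ n ℕ.* k ℕ.^ n
  correct-total = begin
    k ℕ.* ∑ᵛ n #correct
      ≡⟨ cong (k ℕ.*_) (∑ᵛ-comm n (λ c v → ⟦ correct? c v ⟧)) ⟩
    k ℕ.* sum (λ v → ∑ᵛ n (λ c → ⟦ correct? c v ⟧))
      ≡⟨ *-distribˡ-sum k (λ v → ∑ᵛ n (λ c → ⟦ correct? c v ⟧)) ⟩
    sum (λ v → k ℕ.* ∑ᵛ n (λ c → ⟦ correct? c v ⟧))
      -- Independence with the constant 1 as `y`: each vertex is correct in a 1/k share of the
      -- colourings.
      ≡⟨ sum-cong-≗ (λ v → trans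
           (cong (k ℕ.*_) (∑ᵛ-cong (λ c → sym (ℕ.*-identityʳ ⟦ correct? c v ⟧))))
           (correct-independent v (λ _ → 1) (λ _ _ → refl))) ⟩
    sum {n} (λ v → ∑ᵛ {k} n (λ _ → 1))
      ≡⟨ sum-const n _ ⟩
    n ℕ.* ∑ᵛ {k} n (λ _ → 1)
      ≡⟨ cong (n ℕ.*_) (trans (∑ᵛ-const n 1) (ℕ.*-identityʳ (k ℕ.^ n))) ⟩
    n ℕ.* k ℕ.^ n ∎
    where open ≡-Reasoning

  isolated-total : k ℕ.* ∑ᵛ n #isolated ≡ ∑ᵛ n (λ c → sum (λ v → ⟦ quiet? c v ⟧))
  isolated-total = begin
    k ℕ.* ∑ᵛ n #isolated
      ≡⟨ cong (k ℕ.*_) (∑ᵛ-comm n (λ c v → ⟦ correct? c v ⟧ ℕ.* ⟦ quiet? c v ⟧)) ⟩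
    k ℕ.* sum (λ v → ∑ᵛ n (λ c → ⟦ correct? c v ⟧ ℕ.* ⟦ quiet? c v ⟧))
      ≡⟨ *-distribˡ-sum k (λ v → ∑ᵛ n (λ c → ⟦ correct? c v ⟧ ℕ.* ⟦ quiet? c v ⟧)) ⟩
    sum (λ v → k ℕ.* ∑ᵛ n (λ c → ⟦ correct? c v ⟧ ℕ.* ⟦ quiet? c v ⟧))
      ≡⟨ sum-cong-≗ (λ v → correct-independent v (λ c → ⟦ quiet? c v ⟧) (λ c → quiet-update c v)) ⟩
    sum (λ v → ∑ᵛ n (λ c → ⟦ quiet? c v ⟧))
      ≡⟨ ∑ᵛ-comm n (λ c v → ⟦ quiet? c v ⟧) ⟨
    ∑ᵛ n (λ c → sum (λ v → ⟦ quiet? c v ⟧)) ∎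
    where open ≡-Reasoning

  degree≡sum : ∀ u → degree G u ≡ sum (λ v → ⟦ u ~? v ⟧)
  degree≡sum u = length-filter-tabulate (u ~?_) (λ v → v)

  degree≤maxDegree : ∀ u → degree G u ℕ.≤ maxDegree G
  degree≤maxDegree u =
    All.lookup (All.map⁻ (xs≤max 0 (List.map (degree G) (allFin n)))) (∈-allFin u)

  quiet≤maxDegree : ∀ c → ∃[ u ] Correct c u →
    sum (λ v → ⟦ quiet? c v ⟧) ℕ.≤ maxDegree G ℕ.+ #isolated c
  quiet≤maxDegree c (u , cu) = begin
    sum (λ v → ⟦ quiet? c v ⟧)
      ≤⟨ sum-mono bound ⟩
    sum (λ v → ⟦ u ~? v ⟧ ℕ.+ ⟦ correct? c v ⟧ ℕ.* ⟦ quiet? c v ⟧)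
      ≡⟨ ∑-distrib-+ (λ v → ⟦ u ~? v ⟧) _ ⟩
    sum (λ v → ⟦ u ~? v ⟧) ℕ.+ #isolated c
      ≡⟨ cong (ℕ._+ #isolated c) (degree≡sum u) ⟨
    degree G u ℕ.+ #isolated c
      ≤⟨ ℕ.+-monoˡ-≤ (#isolated c) (degree≤maxDegree u) ⟩
    maxDegree G ℕ.+ #isolated c ∎
    where
    open ℕ.≤-Reasoning
    bound : ∀ v → ⟦ quiet? c v ⟧ ℕ.≤ ⟦ u ~? v ⟧ ℕ.+ ⟦ correct? c v ⟧ ℕ.* ⟦ quiet? c v ⟧
    bound v with quiet? c v | correct? c v | u ~? v
    ... | no _  | _      | _      = ℕ.z≤n
    ... | yes _ | yes _  | u~?v   = ℕ.m≤n+m 1 ⟦ u~?v ⟧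
    ... | yes _ | no _   | yes _  = ℕ.≤-refl
    -- Quietness of `v` is tested against the correct vertex `u`, which differs from `v` because `v`
    -- is not correct.
    ... | yes q | no ¬cv | no u≁v = contradiction cu (q u (λ { refl → ¬cv cu }) u≁v)

  one≤correct : ∀ c → ∃[ u ] Correct c u → 1 ℕ.≤ #correct c
  one≤correct c (u , cu) = subst (ℕ._≤ #correct c) (⟦⟧-yes (correct? c u) cu)
    (term≤sum (λ v → ⟦ correct? c v ⟧) u)

  -- Either two vertices are correct, or the only correct one is vacuously quiet and is counted once
  -- in each term.
  two≤isolated+correct : ∀ c → ∃[ u ] Correct c u → 2 ℕ.≤ #isolated c ℕ.+ #correct c
  two≤isolated+correct c (u , cu)
    with Fin.any? (λ w → ¬? (w Fin.≟ u) ×-dec correct? c w)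
  ... | yes (w , w≢u , cw) = ℕ.≤-trans
    (subst₂ (λ i j → i ℕ.+ j ℕ.≤ #correct c)
      (⟦⟧-yes (correct? c w) cw) (⟦⟧-yes (correct? c u) cu)
      (terms≤sum (λ v → ⟦ correct? c v ⟧) w≢u))
    (ℕ.m≤n+m _ (#isolated c))
  ... | no ¬other = ℕ.+-mono-≤
    (subst (ℕ._≤ #isolated c) (cong₂ ℕ._*_ (⟦⟧-yes (correct? c u) cu) (⟦⟧-yes (quiet? c u) quiet))
      (term≤sum (λ v → ⟦ correct? c v ⟧ ℕ.* ⟦ quiet? c v ⟧) u))
    (one≤correct c (u , cu))
    where
    quiet : Quiet c u
    quiet w w≢u _ cw = ¬other (w , w≢u , cw)

-- Inequalities between the maximum degree, the number of vertices and the number of colours.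

maxDegree<n : ∀ {n} .{{_ : NonZero n}} (G : Graph n) → maxDegree G ℕ.< n
maxDegree<n {n@(suc m)} G = ℕ.s≤s (max≤v⁺ {xs = List.map (degree G) (allFin n)} ℕ.z≤n
  (All.map⁺ (All.tabulate (λ {v} _ → bound v))))
  where
  open Graph G
  bound : ∀ v → degree G v ℕ.≤ m
  -- The vertex `v` itself fails the filter, so the list of neighbours is strictly shorter than
  -- `allFin n`.
  bound v = ℕ.≤-pred (subst (degree G v ℕ.<_) (length-tabulate {n = n} (λ i → i))
    (filter-notAll (v ~?_) (allFin n) (Any.map (λ { refl → ~-irr refl }) (∈-allFin v))))

module _ {n s : ℕ} (G : Graph n) (winnable : Winnable G (suc s)) where

  private
    Δ k : ℕ
    Δ = maxDegree G
    k = suc s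
    S : Strategy G k
    S = proj₁ (proj₂ winnable)

  open HatGuessing G S

  private
    T I C : ℕ
    T = k ℕ.^ n
    I = ∑ᵛ n #isolated
    C = ∑ᵛ n #correct

    winner : ∀ c → ∃[ u ] Correct c u
    winner c = proj₂ (proj₂ winnable) (lookup c)

    instance
      T≢0 : NonZero T
      T≢0 = ℕ.m^n≢0 k n

  s*isolated≤ : s ℕ.* I ℕ.≤ T ℕ.* Δ
  -- Since `k` is `suc s`, the product `k * I` unfolds to `I + s * I`, and one copy of `I` cancels.
  s*isolated≤ = ℕ.+-cancelˡ-≤ I _ _ (begin
    k ℕ.* I                                   ≡⟨ isolated-total ⟩
    ∑ᵛ n (λ c → sum (λ v → ⟦ quiet? c v ⟧))   ≤⟨ ∑ᵛ-mono (λ c → quiet≤maxDegree c (winner c)) ⟩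
    ∑ᵛ n (λ c → Δ ℕ.+ #isolated c)            ≡⟨ ∑ᵛ-distrib-+ n (λ _ → Δ) #isolated ⟩
    ∑ᵛ {k} n (λ _ → Δ) ℕ.+ I                  ≡⟨ cong (ℕ._+ I) (∑ᵛ-const n Δ) ⟩
    T ℕ.* Δ ℕ.+ I                             ≡⟨ ℕ.+-comm _ I ⟩
    I ℕ.+ T ℕ.* Δ                             ∎)
    where open ℕ.≤-Reasoning

  -- On average n/k vertices are correct, while a winning strategy always has at least one.
  colours≤n : k ℕ.≤ n
  colours≤n = ℕ.*-cancelʳ-≤ k n T (begin
    k ℕ.* T                        ≡⟨ cong (k ℕ.*_) (trans (∑ᵛ-const n 1) (ℕ.*-identityʳ T)) ⟨
    k ℕ.* ∑ᵛ {k} n (λ _ → 1)       ≤⟨ ℕ.*-monoʳ-≤ k (∑ᵛ-mono (λ c → one≤correct c (winner c))) ⟩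
    k ℕ.* C                        ≡⟨ correct-total ⟩
    n ℕ.* T                        ∎)
    where open ℕ.≤-Reasoning

  -- This is 2 ≤ E[R] + E[X] with E[R] ≤ Δ/s and E[X] = n/k. Multiplying through by `s * k * T`
  -- avoids division, so `s` equal to 0 is no special case.
  colours-bound : 2 ℕ.* (s ℕ.* k) ℕ.≤ k ℕ.* Δ ℕ.+ s ℕ.* n
  colours-bound = ℕ.*-cancelʳ-≤ _ _ T (begin
    2 ℕ.* (s ℕ.* k) ℕ.* T
      ≡⟨ lemma₁ s k T ⟩
    s ℕ.* k ℕ.* (T ℕ.* 2)
      ≡⟨ cong (s ℕ.* k ℕ.*_) (∑ᵛ-const n 2) ⟨
    s ℕ.* k ℕ.* ∑ᵛ {k} n (λ _ → 2)
      ≤⟨ ℕ.*-monoʳ-≤ (s ℕ.* k) (∑ᵛ-mono (λ c → two≤isolated+correct c (winner c))) ⟩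
    s ℕ.* k ℕ.* ∑ᵛ n (λ c → #isolated c ℕ.+ #correct c)
      ≡⟨ cong (s ℕ.* k ℕ.*_) (∑ᵛ-distrib-+ n #isolated #correct) ⟩
    s ℕ.* k ℕ.* (I ℕ.+ C)
      ≡⟨ lemma₂ s k I C ⟩
    k ℕ.* (s ℕ.* I) ℕ.+ s ℕ.* (k ℕ.* C)
      ≡⟨ cong (λ e → k ℕ.* (s ℕ.* I) ℕ.+ s ℕ.* e) correct-total ⟩
    k ℕ.* (s ℕ.* I) ℕ.+ s ℕ.* (n ℕ.* T)
      ≤⟨ ℕ.+-monoˡ-≤ _ (ℕ.*-monoʳ-≤ k s*isolated≤) ⟩
    k ℕ.* (T ℕ.* Δ) ℕ.+ s ℕ.* (n ℕ.* T)
      ≡⟨ lemma₃ s k Δ n T ⟩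
    (k ℕ.* Δ ℕ.+ s ℕ.* n) ℕ.* T ∎)
    where
    open ℕ.≤-Reasoning
    lemma₁ : ∀ s k T → 2 ℕ.* (s ℕ.* k) ℕ.* T ≡ s ℕ.* k ℕ.* (T ℕ.* 2)
    lemma₁ = ℕ-Ring.solve-∀
    lemma₂ : ∀ s k I C → s ℕ.* k ℕ.* (I ℕ.+ C) ≡ k ℕ.* (s ℕ.* I) ℕ.+ s ℕ.* (k ℕ.* C)
    lemma₂ = ℕ-Ring.solve-∀
    lemma₃ : ∀ s k Δ n T → k ℕ.* (T ℕ.* Δ) ℕ.+ s ℕ.* (n ℕ.* T) ≡ (k ℕ.* Δ ℕ.+ s ℕ.* n) ℕ.* T
    lemma₃ = ℕ-Ring.solve-∀

-- From integers to rationals and Dedekind reals.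

private
  ι : ℤ → ℚ
  ι z = z ℚ./ 1

-- The fraction `z / 1` is normalised and does not reduce for a variable `z`. The homomorphism laws
-- below are therefore checked on unnormalised rationals.
ι-toℚᵘ : ∀ z → ℚ.toℚᵘ (ι z) ℚᵘ.≃ ℚᵘ.mkℚᵘ z 0
ι-toℚᵘ z = ℚ.toℚᵘ-fromℚᵘ (ℚᵘ.mkℚᵘ z 0)

ι-homo-+ : ∀ x y → ι (x + y) ≡ ι x ℚ.+ ι y
ι-homo-+ x y = ℚ.toℚᵘ-injective (begin
  ℚ.toℚᵘ (ι (x + y))                  ≈⟨ ι-toℚᵘ (x + y) ⟩
  ℚᵘ.mkℚᵘ (x + y) 0                   ≈⟨ ℚᵘ.*≡* (cong (_* + 1)
                                           (sym (cong₂ _+_ (ℤ.*-identityʳ x) (ℤ.*-identityʳ y)))) ⟩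
  ℚᵘ.mkℚᵘ x 0 ℚᵘ.+ ℚᵘ.mkℚᵘ y 0        ≈⟨ ℚᵘ.+-cong (ι-toℚᵘ x) (ι-toℚᵘ y) ⟨
  ℚ.toℚᵘ (ι x) ℚᵘ.+ ℚ.toℚᵘ (ι y)      ≈⟨ ℚ.toℚᵘ-homo-+ (ι x) (ι y) ⟨
  ℚ.toℚᵘ (ι x ℚ.+ ι y)                ∎)
  where open ℚᵘ.≃-Reasoning

ι-homo-* : ∀ x y → ι (x * y) ≡ ι x ℚ.* ι y
ι-homo-* x y = ℚ.toℚᵘ-injective (begin
  ℚ.toℚᵘ (ι (x * y))                  ≈⟨ ι-toℚᵘ (x * y) ⟩
  ℚᵘ.mkℚᵘ x 0 ℚᵘ.* ℚᵘ.mkℚᵘ y 0        ≈⟨ ℚᵘ.*-cong (ι-toℚᵘ x) (ι-toℚᵘ y) ⟨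
  ℚ.toℚᵘ (ι x) ℚᵘ.* ℚ.toℚᵘ (ι y)      ≈⟨ ℚ.toℚᵘ-homo-* (ι x) (ι y) ⟨
  ℚ.toℚᵘ (ι x ℚ.* ι y)                ∎)
  where open ℚᵘ.≃-Reasoning

ι-homo-neg : ∀ x → ι (ℤ.- x) ≡ ℚ.- ι x
ι-homo-neg x = ℚ.toℚᵘ-injective (begin
  ℚ.toℚᵘ (ι (ℤ.- x))       ≈⟨ ι-toℚᵘ (ℤ.- x) ⟩
  ℚᵘ.- ℚᵘ.mkℚᵘ x 0         ≈⟨ ℚᵘ.-‿cong (ι-toℚᵘ x) ⟨
  ℚᵘ.- ℚ.toℚᵘ (ι x)        ≈⟨ ℚ.toℚᵘ-homo‿- (ι x) ⟨
  ℚ.toℚᵘ (ℚ.- ι x)         ∎)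
  where open ℚᵘ.≃-Reasoning

ι-homo-- : ∀ x y → ι (x - y) ≡ ι x ℚ.- ι y
ι-homo-- x y = trans (ι-homo-+ x (ℤ.- y)) (cong (λ z → ι x ℚ.+ z) (ι-homo-neg y))

ι-mono-≤ : ∀ {x y} → x ℤ.≤ y → ι x ℚ.≤ ι y
ι-mono-≤ {x} {y} x≤y = ℚ.toℚᵘ-cancel-≤ (begin
  ℚ.toℚᵘ (ι x)     ≃⟨ ι-toℚᵘ x ⟩
  ℚᵘ.mkℚᵘ x 0      ≤⟨ ℚᵘ.*≤* (ℤ.*-monoʳ-≤-nonNeg (+ 1) x≤y) ⟩
  ℚᵘ.mkℚᵘ y 0      ≃⟨ ι-toℚᵘ y ⟨
  ℚ.toℚᵘ (ι y)     ∎)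
  where open ℚᵘ.≤-Reasoning

square-mono-< : ∀ {p q} → 0ℚ ℚ.≤ p → p ℚ.< q → p ℚ.* p ℚ.< q ℚ.* q
square-mono-< {p} {q} 0≤p p<q = ℚ.≤-<-trans
  (ℚ.*-monoˡ-≤-nonNeg p {{ℚ.nonNegative 0≤p}} (ℚ.<⇒≤ p<q))
  (ℚ.*-monoˡ-<-pos q {{ℚ.positive (ℚ.≤-<-trans 0≤p p<q)}} p<q)

-- For M = 2h - 2 - Δ the conclusion amounts to M ≤ √D. A rational `q` below `h` is split as
-- `a + b + c`, with `a` just below 1, `b` just below Δ/2, and `c` the remainder.
≤ℝ-quadratic-root : ∀ h Δ D → (h + h - + 2 - Δ) * (h + h - + 2 - Δ) ℤ.≤ D →
  fromℤ h ≤ℝ fromℤ (+ 1) +ℝ fromℤ Δ /2 +ℝ √ (fromℤ D) /2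
≤ℝ-quadratic-root h Δ D M²≤D {q} q<h =
  a ℚ.+ b , c , (a , b , p-η<p 1ℚ , b+b<Δ , refl) , c∈√D , split
  where
  M : ℤ
  M = h + h - + 2 - Δ

  ε η a b c : ℚ
  ε = ι h ℚ.- q
  -- A quarter of the gap: lowering both `a` and `b` by `η` raises `c + c` by 4η = ε, which gives
  -- `c + c` = M - ε, still below M.
  η = ε ℚ.* ½ ℚ.* ½
  a = 1ℚ ℚ.- η
  b = ι Δ ℚ.* ½ ℚ.- η
  c = q ℚ.- (a ℚ.+ b)

  0<ε : 0ℚ ℚ.< ε
  0<ε = subst (ℚ._< ε) (ℚ.+-inverseʳ q) (ℚ.+-monoˡ-< (ℚ.- q) q<h)

  0<η : 0ℚ ℚ.< η
  0<η = ℚ.*-monoˡ-<-pos ½ (ℚ.*-monoˡ-<-pos ½ 0<ε)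

  p-r<p : ∀ p {r} → 0ℚ ℚ.< r → p ℚ.- r ℚ.< p
  p-r<p p {r} 0<r = subst (p ℚ.- r ℚ.<_) (ℚ.+-identityʳ p) (ℚ.+-monoʳ-< p (ℚ.neg-antimono-< 0<r))

  p-η<p : ∀ p → p ℚ.- η ℚ.< p
  p-η<p p = p-r<p p 0<η

  open +-*-Solver

  b+b<Δ : b ℚ.+ b ℚ.< ι Δ
  b+b<Δ = subst (b ℚ.+ b ℚ.<_)
    (solve 1 (λ x → x :* con ½ :+ x :* con ½ := x) refl (ι Δ))
    (ℚ.+-mono-< (p-η<p (ι Δ ℚ.* ½)) (p-η<p (ι Δ ℚ.* ½)))

  split : q ≡ a ℚ.+ b ℚ.+ c
  split = solve 2 (λ q p → q := p :+ (q :- p)) refl q (a ℚ.+ b)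

  ιM : ι M ≡ ι h ℚ.+ ι h ℚ.- ι (+ 2) ℚ.- ι Δ
  ιM = trans (ι-homo-- (h + h - + 2) Δ) (cong (ℚ._- ι Δ)
    (trans (ι-homo-- (h + h) (+ 2)) (cong (ℚ._- ι (+ 2)) (ι-homo-+ h h))))

  c+c<M : c ℚ.+ c ℚ.< ι M
  c+c<M = subst (ℚ._< ι M) (sym eq) (p-r<p (ι M) 0<ε)
    where
    eq : c ℚ.+ c ≡ ι M ℚ.- ε
    eq = trans
      (solve 3 (λ q h Δ →
        let η = (h :- q) :* con ½ :* con ½
            c = q :- (con 1ℚ :- η :+ (Δ :* con ½ :- η))
        in c :+ c := h :+ h :- con (ι (+ 2)) :- Δ :- (h :- q)) refl q (ι h) (ι Δ))
      (cong (ℚ._- ε) (sym ιM))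

  c∈√D : c ℚ.+ c ℚ.< 0ℚ ⊎ (c ℚ.+ c) ℚ.* (c ℚ.+ c) ℚ.< ι D
  -- Negative rationals lie below every `√`; otherwise 0 ≤ `c + c` < M, and squaring preserves the
  -- order. Hence M may have either sign.
  c∈√D with c ℚ.+ c ℚ.<? 0ℚ
  ... | yes <0 = inj₁ <0
  ... | no  ≮0 = inj₂ (ℚ.<-≤-trans (square-mono-< (ℚ.≮⇒≥ ≮0) c+c<M)
    (subst (ℚ._≤ ι D) (ι-homo-* M M) (ι-mono-≤ M²≤D)))

-- The integer inequality behind completing the square.

m+n≡o⇒n≡o-m : ∀ m n {o} → m ℕ.+ n ≡ o → + n ≡ + o - + m
m+n≡o⇒n≡o-m m n refl = identity (+ m) (+ n)
  where
  identity : ∀ x y → y ≡ x + y - x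
  identity = ℤ-Ring.solve-∀

-- With n = Δ + 1 + d and n = k + e, the difference of the two sides is 4se if
-- d = 0, and otherwise 2(w + (d − 1)e) with w the slack in the hypothesis.
discriminant-bound : ∀ n s Δ → suc s ℕ.≤ n → Δ ℕ.< n →
  2 ℕ.* (s ℕ.* suc s) ℕ.≤ suc s ℕ.* Δ ℕ.+ s ℕ.* n →
  let M = + suc s + + suc s - + 2 - + Δ in
  M * M ℤ.≤ (+ Δ + + 2) ^ 2 + + 2 * ((+ n) ^ 2 - + 3 * + n - + n * + Δ)
discriminant-bound n s Δ s<n Δ<n bound with ℕ.m≤n⇒∃[o]m+o≡n s<n | ℕ.m≤n⇒∃[o]m+o≡n Δ<n
... | e , eq | zero , refl
  with refl ← trans (ℕ.suc-injective eq) (ℕ.+-identityʳ Δ) =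
  subst (M * M ℤ.≤_)
    (trans (cong (_+_ (M * M)) (trans (ℤ.pos-* 4 (s ℕ.* e)) (cong (+ 4 *_) (ℤ.pos-* s e))))
      (identity (+ s) (+ e)))
    (ℤ.i≤i+j (M * M) (+ (4 ℕ.* (s ℕ.* e))))
  where
  M : ℤ
  M = + suc s + + suc s - + 2 - + Δ
  -- Here Δ has become `s + e`. The squares are expanded and `n` keeps its `+ 0`, so that the
  -- instance matches the goal by computation.
  identity : ∀ s e →
    let M = (+ 1 + s) + (+ 1 + s) - + 2 - (s + e) ; n = + 1 + (s + e + + 0) in
    M * M + + 4 * (s * e)
      ≡ (s + e + + 2) * ((s + e + + 2) * + 1) + + 2 * (n * (n * + 1) - + 3 * n - n * (s + e))
  identity = ℤ-Ring.solve-∀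
... | e , eq | suc f , refl with ℕ.m≤n⇒∃[o]m+o≡n bound
...   | w , eqw = subst (M * M ℤ.≤_) (trans (cong (_+_ (M * M)) slack) (identity (+ s) (+ Δ) (+ f)))
    (ℤ.i≤i+j (M * M) (+ (2 ℕ.* (w ℕ.+ f ℕ.* e))))
  where
  M : ℤ
  M = + suc s + + suc s - + 2 - + Δ
  -- The naturals `w` and `e` are rewritten as integer differences, leaving a polynomial identity in
  -- `s`, `Δ` and `f` for the ring solver.
  slack : + (2 ℕ.* (w ℕ.+ f ℕ.* e)) ≡
    + 2 * ((+ suc s * + Δ + + s * + n - + 2 * (+ s * + suc s)) + + f * (+ n - + suc s))
  slack = trans (ℤ.pos-* 2 (w ℕ.+ f ℕ.* e)) (cong (+ 2 *_) (cong₂ _+_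
    (trans (m+n≡o⇒n≡o-m (2 ℕ.* (s ℕ.* suc s)) w eqw) (cong₂ _-_
      (cong₂ _+_ (ℤ.pos-* (suc s) Δ) (ℤ.pos-* s n))
      (trans (ℤ.pos-* 2 (s ℕ.* suc s)) (cong (+ 2 *_) (ℤ.pos-* s (suc s))))))
    (trans (ℤ.pos-* f e) (cong (+ f *_) (m+n≡o⇒n≡o-m (suc s) e eq)))))
  identity : ∀ s Δ f →
    let M = (+ 1 + s) + (+ 1 + s) - + 2 - Δ ; n = + 1 + (Δ + (+ 1 + f)) in
    M * M + + 2 * (((+ 1 + s) * Δ + s * n - + 2 * (s * (+ 1 + s))) + f * (n - (+ 1 + s)))
      ≡ (Δ + + 2) * ((Δ + + 2) * + 1) + + 2 * (n * (n * + 1) - + 3 * n - n * Δ)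
  identity = ℤ-Ring.solve-∀

theorem1p1 : ∀ (n : ℕ) .{{_ : NonZero n}} (G : Graph n) (h : ℕ) → IsHatGuessingNumber G h →
    let Δ = maxDegree G in
    fromℤ (+ h) ≤ℝ
    fromℤ (+ 1) +ℝ fromℤ (+ Δ) /2
    +ℝ √ (fromℤ ((+ Δ + + 2) ^ 2 + + 2 * ((+ n) ^ 2 - + 3 * + n - + n * + Δ))) /2
-- `Winnable` demands at least one colour, so `h` is a successor.
theorem1p1 n G zero    (winnable , _) = contradiction (proj₁ winnable) λ ()
theorem1p1 n G (suc s) (winnable , _) = ≤ℝ-quadratic-root (+ suc s) (+ maxDegree G) _
  (discriminant-bound n s (maxDegree G) (colours≤n G winnable) (maxDegree<n G) (colours-bound G winnable))
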